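{- Let $k \ge 1$ and $t \ge 0$ be integers, and let $w$ be a (finite or infinite) word over an alphabet of $k$ letters that avoids split occurrences of $t$-overlaps; that is, no factor of $w$ is a split occurrence of a $t$-overlap. Then $w$ is finite. (Equivalently, every infinite word over a $k$-letter alphabet contains a split occurrence of a $t$-overlap.)
   Context: A word $y$ is a factor of a word $w$ if $w = pyq$ for some (possibly empty) words $p, q$ (with $q$ infinite if $w$ is infinite); that is, a factor is a finite contiguous block. For an integer $t \ge 0$, a $t$-overlap is a word of the form $xxx'$, where $x$ is a nonempty finite word of length at least $t$ and $x'$ is the prefix of $x$ of length $t$. A split occurrence of a $t$-overlap is a finite word of the form $xyz$ (the words $x,y,z$ are allowed to be empty) such that $xz$ is a $t$-overlap. Infinite words are one-sided sequences indexed by the natural numbers. -}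

module Defs where

open import Data.List using (List; []; _∷_; _++_; length; take)
open import Data.Nat using (ℕ; zero; suc; _≤_)
open import Data.Product using (_×_; ∃-syntax)
open import Relation.Binary.PropositionalEquality using (_≡_; _≢_; _≗_)
open import Relation.Nullary using (¬_)

infixr 5 _++ω_

data Word (A : Set) : Set where
  finite   : List A → Word A
  infinite : (ℕ → A) → Word A

_++ω_ : {A : Set} → List A → (ℕ → A) → (ℕ → A)
([]      ++ω q) n       = q n
((a ∷ p) ++ω q) zero    = a
((a ∷ p) ++ω q) (suc n) = (p ++ω q) n

-- Infinite words are compared letter by letter, as function extensionality
-- is not available.
IsFactor : {A : Set} → List A → Word A → Set
IsFactor y (finite w)   = ∃[ p ] ∃[ q ] w ≡ p ++ y ++ q
IsFactor y (infinite w) = ∃[ p ] ∃[ q ] w ≗ p ++ω y ++ω q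

IsOverlap : {A : Set} → ℕ → List A → Set
IsOverlap t u = ∃[ x ] x ≢ [] × t ≤ length x × u ≡ x ++ x ++ take t x

IsSplitOverlap : {A : Set} → ℕ → List A → Set
IsSplitOverlap t u =
  ∃[ x ] ∃[ y ] ∃[ z ] u ≡ x ++ y ++ z × IsOverlap t (x ++ z)

ContainsSplitOverlap : {A : Set} → ℕ → Word A → Set
ContainsSplitOverlap t w = ∃[ u ] IsFactor u w × IsSplitOverlap t u

AvoidsSplitOverlaps : {A : Set} → ℕ → Word A → Set
AvoidsSplitOverlaps t w = ∀ u → IsFactor u w → ¬ IsSplitOverlap t u

IsFinite : {A : Set} → Word A → Set
IsFinite w = ∃[ u ] w ≡ finite u

{-# OPTIONS --safe #-}
-- Two applications of the pigeonhole principle. Among boundedly many disjoint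
-- blocks of length t two coincide, so every word c of a certain length D has a
-- factor a b a with |a| = t and b nonempty. Likewise some word c of length D
-- has two disjoint occurrences in w. Take a b a in the first and b a in the
-- second: deleting what lies between leaves a b a b a, a t-overlap with x = a b.
module Submission where

open import Defs
open import Data.Empty using (⊥-elim)
open import Data.Fin using (Fin; toℕ; funToFin)
open import Data.Fin.Properties using (combine-injective; pigeonhole; toℕ<n)
open import Data.List using (List; []; _∷_; _++_; length; take; applyUpTo)
open import Data.List.Properties
  using (++-assoc; ++-monoid; length-++; length-applyUpTo)
open import Data.Nat using (ℕ; zero; suc; _+_; _*_; _^_; _≤_)
open import Data.Nat.Properties
  using (*-monoˡ-≤; +-assoc; +-comm; +-suc; m≤m+n; m≤n⇒∃[o]m+o≡n; n<1+n)
open import Data.Product using (_×_; _,_; ∃-syntax)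
open import Function using (_∘_)
open import Relation.Binary.PropositionalEquality
  using (_≡_; _≢_; _≗_; refl; sym; trans; cong; cong₂; subst; module ≡-Reasoning)
open import Tactic.MonoidSolver using (solve)

private variable
  A : Set

take-length-++ : (xs ys : List A) → take (length xs) (xs ++ ys) ≡ xs
take-length-++ []       ys = refl
take-length-++ (x ∷ xs) ys = cong (x ∷_) (take-length-++ xs ys)

applyUpTo-+ : (f : ℕ → A) (m n : ℕ) →
  applyUpTo f (m + n) ≡ applyUpTo f m ++ applyUpTo (f ∘ (m +_)) n
applyUpTo-+ f zero    n = refl
applyUpTo-+ f (suc m) n = cong (f 0 ∷_) (applyUpTo-+ (f ∘ suc) m n)

applyUpTo-++ω : (xs : List A) (f : ℕ → A) →
  applyUpTo (xs ++ω f) (length xs) ≡ xs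
applyUpTo-++ω []       f = refl
applyUpTo-++ω (x ∷ xs) f = cong (x ∷_) (applyUpTo-++ω xs f)

++ω-decompose : (f : ℕ → A) (n : ℕ) → f ≗ applyUpTo f n ++ω (f ∘ (n +_))
++ω-decompose f zero    i       = refl
++ω-decompose f (suc n) zero    = refl
++ω-decompose f (suc n) (suc i) = ++ω-decompose (f ∘ suc) n i

++ω-assoc : (xs ys : List A) (f : ℕ → A) → (xs ++ ys) ++ω f ≗ xs ++ω ys ++ω f
++ω-assoc []       ys f i       = refl
++ω-assoc (x ∷ xs) ys f zero    = refl
++ω-assoc (x ∷ xs) ys f (suc i) = ++ω-assoc xs ys f i

++ω-congʳ : (xs : List A) {f g : ℕ → A} → f ≗ g → xs ++ω f ≗ xs ++ω g
++ω-congʳ []       f≗g i       = f≗g i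
++ω-congʳ (x ∷ xs) f≗g zero    = refl
++ω-congʳ (x ∷ xs) f≗g (suc i) = ++ω-congʳ xs f≗g i

-- The letters of `w` from position `n` on are absorbed into the right-hand context, so factors can
-- be located by rearranging finite lists alone.
isFactor-prefix : (w : ℕ → A) (n : ℕ) (p y q : List A) →
  applyUpTo w n ≡ p ++ y ++ q → IsFactor y (infinite w)
isFactor-prefix w n p y q eq = p , q ++ω rest , λ i → begin
  w i                             ≡⟨ ++ω-decompose w n i ⟩
  (applyUpTo w n ++ω rest) i      ≡⟨ cong (λ l → (l ++ω rest) i) eq ⟩
  ((p ++ y ++ q) ++ω rest) i      ≡⟨ ++ω-assoc p (y ++ q) rest i ⟩
  (p ++ω (y ++ q) ++ω rest) i     ≡⟨ ++ω-congʳ p (++ω-assoc y q rest) i ⟩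
  (p ++ω y ++ω q ++ω rest) i      ∎
  where
  open ≡-Reasoning
  rest = w ∘ (n +_)

-- `funToFin` pairs the first letter with the code of the rest by `combine`, so equal codes can be
-- peeled letter by letter. Concluding with lists avoids function extensionality.
applyUpTo-funToFin-injective : ∀ {k} n (f g : ℕ → Fin k) →
  funToFin {n} (f ∘ toℕ) ≡ funToFin {n} (g ∘ toℕ) → applyUpTo f n ≡ applyUpTo g n
applyUpTo-funToFin-injective zero    f g eq = refl
applyUpTo-funToFin-injective (suc n) f g eq
  with head≡ , tail≡ ← combine-injective (f 0) _ (g 0) _ eq
  = cong₂ _∷_ head≡ (applyUpTo-funToFin-injective n (f ∘ suc) (g ∘ suc) tail≡)

-- One block more than the `k ^ n` words of length `n`, each block taking `suc n` letters.
repetitionBound : ℕ → ℕ → ℕ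
repetitionBound k n = suc (k ^ n) * suc n

HasRepetition : ℕ → List A → Set
HasRepetition n c =
  ∃[ u ] ∃[ a ] ∃[ b ] ∃[ v ] c ≡ u ++ a ++ b ++ a ++ v × length a ≡ n × b ≢ []

-- The blocks start at multiples of suc n rather than n: this separates the two
-- copies, and keeps the starting points distinct when n = 0.
prefix-hasRepetition : ∀ {k} (w : ℕ → Fin k) n →
  HasRepetition n (applyUpTo w (repetitionBound k n))
prefix-hasRepetition {k} w n
  with i , j , i<j , code≡ ← pigeonhole (n<1+n (k ^ n))
         (λ i → funToFin {n} (λ r → w (toℕ i * suc n + toℕ r)))
  -- Block `j` starts at least `suc n` letters after block `i`. With `o` the excess, the gap `b`
  -- between the two copies has length `suc o`, hence is nonempty.
  with o , i+o≡j ← m≤n⇒∃[o]m+o≡n (*-monoˡ-≤ (suc n) i<j)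
  -- Block `j` and its separating letter still fit within the bound, with `l` letters to spare.
  with l , j+l≡N ← m≤n⇒∃[o]m+o≡n (*-monoˡ-≤ (suc n) (toℕ<n j))
  = u , a , b , v , decomposition , length-applyUpTo wₚ n , λ ()
  where
  open ≡-Reasoning
  p = toℕ i * suc n
  q = toℕ j * suc n
  wₚ = w ∘ (p +_)

  q≡ : p + (n + suc o) ≡ q
  q≡ = begin
    p + (n + suc o)  ≡⟨ cong (p +_) (+-suc n o) ⟩
    p + (suc n + o)  ≡⟨ +-assoc p (suc n) o ⟨
    p + suc n + o    ≡⟨ cong (_+ o) (+-comm p (suc n)) ⟩
    suc n + p + o    ≡⟨ i+o≡j ⟩
    q                ∎

  N≡ : q + (n + suc l) ≡ repetitionBound k n
  N≡ = begin
    q + (n + suc l)  ≡⟨ cong (q +_) (+-suc n l) ⟩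
    q + (suc n + l)  ≡⟨ +-assoc q (suc n) l ⟨
    q + suc n + l    ≡⟨ cong (_+ l) (+-comm q (suc n)) ⟩
    suc n + q + l    ≡⟨ j+l≡N ⟩
    repetitionBound k n ∎

  u = applyUpTo w p
  a = applyUpTo wₚ n
  b = applyUpTo (wₚ ∘ (n +_)) (suc o)
  v = applyUpTo (w ∘ (q +_) ∘ (n +_)) (suc l)

  decomposition : applyUpTo w (repetitionBound k n) ≡ u ++ a ++ b ++ a ++ v
  decomposition = begin
    applyUpTo w (repetitionBound k n)
      ≡⟨ cong (applyUpTo w) N≡ ⟨
    applyUpTo w (q + (n + suc l))
      ≡⟨ applyUpTo-+ w q (n + suc l) ⟩
    applyUpTo w q ++ applyUpTo (w ∘ (q +_)) (n + suc l)
      ≡⟨ cong₂ _++_ (cong (applyUpTo w) (sym q≡)) (applyUpTo-+ (w ∘ (q +_)) n (suc l)) ⟩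
    applyUpTo w (p + (n + suc o)) ++ applyUpTo (w ∘ (q +_)) n ++ v
      ≡⟨ cong₂ _++_ (trans (applyUpTo-+ w p (n + suc o))
                           (cong (u ++_) (applyUpTo-+ wₚ n (suc o))))
           (cong (_++ v) (sym (applyUpTo-funToFin-injective n wₚ (w ∘ (q +_)) code≡))) ⟩
    (u ++ a ++ b) ++ a ++ v
      ≡⟨ ++-assoc u (a ++ b) (a ++ v) ⟩
    u ++ (a ++ b) ++ a ++ v
      ≡⟨ cong (u ++_) (++-assoc a b (a ++ v)) ⟩
    u ++ a ++ b ++ a ++ v ∎

-- Here `w` only serves to extend `c` to an infinite word, of which `c` is a prefix.
hasRepetition : ∀ {k} n (w : ℕ → Fin k) (c : List (Fin k)) →
  length c ≡ repetitionBound k n → HasRepetition n c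
hasRepetition n w c |c|≡ = subst (HasRepetition n)
  (trans (cong (applyUpTo (c ++ω w)) (sym |c|≡)) (applyUpTo-++ω c w))
  (prefix-hasRepetition (c ++ω w) n)

-- Take x = `a ++ b`, whose prefix of length `length a` is `a`. The word is bracketed at the place
-- where the split will occur.
isOverlap : (a b : List A) → b ≢ [] →
  IsOverlap (length a) ((a ++ b ++ a) ++ b ++ a)
isOverlap {A} a b b≢[] =
  a ++ b , nonempty a b b≢[] ,
  subst (length a ≤_) (sym (length-++ a)) (m≤m+n _ _) , (begin
  (a ++ b ++ a) ++ b ++ a                            ≡⟨ solve (++-monoid A) ⟩
  (a ++ b) ++ (a ++ b) ++ a                          ≡⟨ cong (λ l → (a ++ b) ++ (a ++ b) ++ l) (take-length-++ a b) ⟨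
  (a ++ b) ++ (a ++ b) ++ take (length a) (a ++ b)   ∎)
  where
  open ≡-Reasoning
  nonempty : (xs ys : List A) → ys ≢ [] → xs ++ ys ≢ []
  nonempty [] ys ys≢[] = ys≢[]
  nonempty (_ ∷ _) ys ys≢[] ()

containsSplitOverlap : ∀ {k} t (w : ℕ → Fin k) → ContainsSplitOverlap t (infinite w)
containsSplitOverlap {k} t w
  -- The bound is nested: the repeated factor `c` is long enough to contain a repetition itself.
  with u′ , c , y , v′ , w≡ , |c|≡ , _ ← prefix-hasRepetition w (repetitionBound k t)
  with u , a , b , v , refl , refl , b≢[] ← hasRepetition t w c |c|≡
  = s , isFactor-prefix w N (u′ ++ u) s (v ++ v′) (trans w≡ rearrange)
  -- The deleted middle is the end `v` of the first `c`, the gap `y`, and the beginning `u ++ a` of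
  -- the second `c`.
  , (a ++ b ++ a , v ++ y ++ u ++ a , b ++ a , refl , isOverlap a b b≢[])
  where
  s = (a ++ b ++ a) ++ (v ++ y ++ u ++ a) ++ (b ++ a)
  N = repetitionBound k (repetitionBound k t)
  rearrange :
    u′ ++ (u ++ a ++ b ++ a ++ v) ++ y ++ (u ++ a ++ b ++ a ++ v) ++ v′ ≡
    (u′ ++ u) ++ s ++ v ++ v′
  rearrange = solve (++-monoid (Fin k))

theorem2 : ∀ (k t : ℕ) → 1 ≤ k →
    (∀ (w : Word (Fin k)) → AvoidsSplitOverlaps t w → IsFinite w)
    × (∀ (w : ℕ → Fin k) → ContainsSplitOverlap t (infinite w))
theorem2 k t 1≤k = avoiding⇒finite , containsSplitOverlap t
  where
  avoiding⇒finite : (w : Word (Fin k)) → AvoidsSplitOverlaps t w → IsFinite w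
  avoiding⇒finite (finite u)   _      = u , refl
  avoiding⇒finite (infinite w) avoids
    with u , factor , split ← containsSplitOverlap t w
    = ⊥-elim (avoids u factor split)
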